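{- Every matrogenic graph has the strong Havel--Hakimi property. Hence every matroidal graph and every threshold graph also has the strong Havel--Hakimi property.
   Context: All graphs are finite and simple. A vertex $v$ of a graph $G$ has the Havel--Hakimi property (in $G$) if $v$ has maximum degree in $G$ and no vertex adjacent to $v$ has degree smaller than that of some vertex not adjacent to $v$; that is, $d_G(w)\ge d_G(u)$ for every neighbor $w$ of $v$ and every vertex $u\neq v$ not adjacent to $v$. A graph $G$ has the strong Havel--Hakimi property if in every induced subgraph $H$ of $G$, every vertex of maximum degree in $H$ has the Havel--Hakimi property in $H$. An alternating 4-cycle in $G$ is a configuration on four distinct vertices $a,b,c,d$ of $G$ in which $ab$ and $cd$ are edges and $ac$ and $bd$ are non-edges (no condition on the pairs $ad$, $bc$). A set of four vertices is the vertex set of an alternating 4-cycle if and only if it induces $2K_2$, $P_4$ or $C_4$. A graph $G$ is matrogenic if the vertex sets of the alternating 4-cycles of $G$ are the circuits of a matroid with ground set $V(G)$. A graph $G$ is matroidal if the edge sets $\{ab,cd\}$ of the alternating 4-cycles of $G$ are the circuits of a matroid with ground set $E(G)$. A graph is a threshold graph if it contains no alternating 4-cycle (equivalently, it has no induced subgraph isomorphic to $2K_2$, $P_4$, or $C_4$). -}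

module Defs where

open import Data.Fin using (Fin; _<_)
open import Data.Fin.Subset using (Subset; ∣_∣)
open import Data.List using ([]; _∷_)
open import Data.List.Relation.Unary.Unique.Propositional using (Unique)
open import Data.Nat using (ℕ; _≤_)
open import Data.Product using (_×_; ∃-syntax; Σ)
open import Data.Sum using (_⊎_)
open import Data.Vec using (tabulate)
open import Function using (_↣_; Injection; _⇔_)
open import Level using (0ℓ)
open import Relation.Binary.Core using (Rel)
open import Relation.Binary.Definitions using (Decidable; Symmetric; Irreflexive)
open import Relation.Binary.PropositionalEquality using (_≡_; _≢_; cong)
open import Relation.Nullary using (¬_; does)
open import Relation.Unary using (Pred; ∅; ｛_｝; _∈_; _⊆_; _≐_; _∪_; _∖_)

record Graph (n : ℕ) : Set₁ where
  infix 4 _~_ _~?_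
  field
    _~_    : Rel (Fin n) 0ℓ
    _~?_   : Decidable _~_
    sym    : Symmetric _~_
    irrefl : Irreflexive _≡_ _~_

  neighbours : Fin n → Subset n
  neighbours v = tabulate (λ u → does (v ~? u))

  degree : Fin n → ℕ
  degree v = ∣ neighbours v ∣

  MaximumDegree : Fin n → Set
  MaximumDegree v = ∀ u → degree u ≤ degree v

  HavelHakimi : Fin n → Set
  HavelHakimi v = MaximumDegree v ×
    (∀ w u → v ~ w → u ≢ v → ¬ v ~ u → degree u ≤ degree w)

  record AlternatingFourCycle (a b c d : Fin n) : Set where
    field
      distinct : Unique (a ∷ b ∷ c ∷ d ∷ [])
      ab-edge  : a ~ b
      cd-edge  : c ~ d
      ac-non   : ¬ a ~ c
      bd-non   : ¬ b ~ d

  -- The condition lo < hi selects one representative of each unordered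
  -- pair; with the proofs irrelevant, edges with the same ends are equal.
  record Edge : Set where
    field
      lo hi  : Fin n
      .lo<hi : lo < hi
      .adj   : lo ~ hi

  Joins : Edge → Fin n → Fin n → Set
  Joins e a b = (lo ≡ a × hi ≡ b) ⊎ (lo ≡ b × hi ≡ a)
    where open Edge e

  AlternatingVertexSet : Pred (Fin n) 0ℓ → Set
  AlternatingVertexSet S = ∃[ a ] ∃[ b ] ∃[ c ] ∃[ d ]
    AlternatingFourCycle a b c d × S ≐ (｛ a ｝ ∪ ｛ b ｝ ∪ ｛ c ｝ ∪ ｛ d ｝)

  AlternatingEdgeSet : Pred Edge 0ℓ → Set
  AlternatingEdgeSet S = ∃[ a ] ∃[ b ] ∃[ c ] ∃[ d ]
    AlternatingFourCycle a b c d × S ≐ (λ e → Joins e a b ⊎ Joins e c d)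

-- The subgraph induced on the image of f, with vertices relabelled along f.
-- Every vertex subset with m elements is the image of some f : Fin m ↣ Fin n.
induced : ∀ {m n} → Graph n → Fin m ↣ Fin n → Graph m
induced G f = record
  { _~_    = λ u v → to u ~ to v
  ; _~?_   = λ u v → to u ~? to v
  ; sym    = sym
  ; irrefl = λ u≡v → irrefl (cong to u≡v)
  }
  where
  open Graph G
  open Injection f using (to)

StrongHavelHakimi : ∀ {n} → Graph n → Set
StrongHavelHakimi {n} G = ∀ {m} (f : Fin m ↣ Fin n) →
  let open Graph (induced G f) in
  ∀ v → MaximumDegree v → HavelHakimi v

-- Matroids by circuit axioms.  Subsets of the ground set are predicates, so
-- equality of sets is _≐_.  Finiteness of the ground set is not a field: the
-- ground sets used below are Fin n and the edge type of a finite graph.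
record Matroid (E : Set) : Set₁ where
  field
    Circuit      : Pred E 0ℓ → Set
    respects     : ∀ {S T} → S ≐ T → Circuit S → Circuit T
    nonempty     : ¬ Circuit ∅
    incomparable : ∀ {S T} → Circuit S → Circuit T → S ⊆ T → S ≐ T
    elimination  : ∀ {S T} {e : E} → Circuit S → Circuit T → ¬ (S ≐ T) →
                   e ∈ S → e ∈ T →
                   ∃[ U ] (Circuit U × U ⊆ ((S ∪ T) ∖ ｛ e ｝))

AreCircuitsOfMatroid : ∀ {E : Set} → (Pred E 0ℓ → Set) → Set₁
AreCircuitsOfMatroid {E} C =
  Σ (Matroid E) λ M → ∀ S → C S ⇔ Matroid.Circuit M S

Matrogenic : ∀ {n} → Graph n → Set₁
Matrogenic G = AreCircuitsOfMatroid (Graph.AlternatingVertexSet G)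

Matroidal : ∀ {n} → Graph n → Set₁
Matroidal G = AreCircuitsOfMatroid (Graph.AlternatingEdgeSet G)

Threshold : ∀ {n} → Graph n → Set
Threshold G = ∀ {a b c d} → ¬ Graph.AlternatingFourCycle G a b c d

{-# OPTIONS --safe #-}

-- Suppose that w is a neighbour of v, that u ≢ v is a non-neighbour of v, and
-- that u has larger degree than w.  Since v lies in N(w) but not in N(u),
-- counting gives two vertices x, y adjacent to u but not to w.  The
-- alternating 4-cycles u x v w and u y v w then violate circuit elimination:
-- eliminating v leaves {u, w, x, y}, and eliminating the edge vw leaves
-- {ux, uy}, neither of which comes from an alternating 4-cycle.  Only the
-- adjacencies among u, w, v, x, y matter, so the argument applies to every
-- induced subgraph.
module Submission where

open import Defs
open import Data.Empty using (⊥; ⊥-elim-irr)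
open import Data.Fin using (Fin; zero; suc; _≟_)
import Data.Fin.Properties as Fin
open import Data.Fin.Subset
  using (Subset; inside; outside; ∣_∣; ⁅_⁆; _∪_; _-_; _∈_; _∉_)
open import Data.Fin.Subset.Properties
  using (_∈?_; p⊆q⇒∣p∣≤∣q∣; p⊆p∪q; q⊆p∪q; ∪-identityʳ;
         x∈⁅x⁆; x∈p⇒∣p-x∣<∣p∣; x∈p∧x≢y⇒x∈p-y)
open import Data.List.Relation.Unary.All using ([]; _∷_)
open import Data.List.Relation.Unary.AllPairs using ([]; _∷_)
open import Data.Nat using (suc; _≤_; _<_; s≤s)
open import Data.Nat.Properties
  using (≤-reflexive; ≤-trans; ≤-<-trans; <⇒≱; ≮⇒≥; n≤1+n)
open import Data.Product using (_×_; _,_; proj₁; proj₂; ∃-syntax)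
open import Data.Sum using (_⊎_; inj₁; inj₂)
open import Data.Vec using (_∷_)
open import Data.Vec.Properties using (lookup⇒[]=; []=⇒lookup; lookup∘tabulate)
open import Function using (_∘_; _↣_; Injection; Equivalence)
open import Relation.Binary.Definitions using (tri<; tri≈; tri>)
open import Relation.Binary.PropositionalEquality
  using (_≡_; _≢_; refl; sym; trans; cong; ≢-sym)
open import Relation.Nullary using (¬_; yes; no; contradiction)
open import Relation.Nullary.Decidable using (_×-dec_; ¬?; dec-true; decidable-stable)
import Relation.Unary as Pred

-- Counting in finite sets.

∣p∪⁅x⁆∣≤1+∣p∣ : ∀ {n} (p : Subset n) x → ∣ p ∪ ⁅ x ⁆ ∣ ≤ suc ∣ p ∣
∣p∪⁅x⁆∣≤1+∣p∣ (inside  ∷ p) zero    =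
  s≤s (≤-trans (≤-reflexive (cong ∣_∣ (∪-identityʳ p))) (n≤1+n _))
∣p∪⁅x⁆∣≤1+∣p∣ (outside ∷ p) zero    = s≤s (≤-reflexive (cong ∣_∣ (∪-identityʳ p)))
∣p∪⁅x⁆∣≤1+∣p∣ (inside  ∷ p) (suc x) = s≤s (∣p∪⁅x⁆∣≤1+∣p∣ p x)
∣p∪⁅x⁆∣≤1+∣p∣ (outside ∷ p) (suc x) = ∣p∪⁅x⁆∣≤1+∣p∣ p x

∣q∣<∣p∣⇒p⊈q : ∀ {n} {p q : Subset n} → ∣ q ∣ < ∣ p ∣ → ∃[ x ] x ∈ p × x ∉ q
∣q∣<∣p∣⇒p⊈q {p = p} {q} q<p with Fin.any? (λ x → (x ∈? p) ×-dec ¬? (x ∈? q))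
... | yes found = found
... | no  none  = contradiction (p⊆q⇒∣p∣≤∣q∣ p⊆q) (<⇒≱ q<p)
  where
  p⊆q : ∀ {x} → x ∈ p → x ∈ q
  p⊆q {x} x∈p = decidable-stable (x ∈? q) λ x∉q → none (x , x∈p , x∉q)

-- Blocks `x` in addition to the rest of `q`; giving up `v` in return keeps the set no larger than
-- `q` when `v` lies in `q`.
exchange : ∀ {n} → Subset n → Fin n → Fin n → Subset n
exchange q v x = (q - v) ∪ ⁅ x ⁆

∣exchange∣≤ : ∀ {n} {q : Subset n} {v} → v ∈ q → ∀ x → ∣ exchange q v x ∣ ≤ ∣ q ∣
∣exchange∣≤ {q = q} {v} v∈q x = ≤-trans (∣p∪⁅x⁆∣≤1+∣p∣ (q - v) x) (x∈p⇒∣p-x∣<∣p∣ v∈q)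

∈-exchange : ∀ {n} {q : Subset n} {v y} x → y ∈ q → y ≢ v → y ∈ exchange q v x
∈-exchange x y∈q y≢v = p⊆p∪q ⁅ x ⁆ (x∈p∧x≢y⇒x∈p-y y∈q y≢v)

-- Giving up `v` does no harm: it is not in `p`, so it cannot be `y`.
∉-exchange : ∀ {n} {p q : Subset n} {v x y} → v ∉ p → y ∈ p →
             y ∉ exchange q v x → y ∉ q × y ≢ x
∉-exchange {q = q} {v} {x} v∉p y∈p y∉ =
  (λ y∈q → y∉ (∈-exchange x y∈q λ { refl → v∉p y∈p })) ,
  λ { refl → y∉ (q⊆p∪q (q - v) ⁅ x ⁆ (x∈⁅x⁆ x)) }

-- Size gives a first `x`. With `v` traded for `x`, the set `q` is still smaller than `p`, so size
-- gives a second element, distinct from `x`.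
two-outside : ∀ {n} {p q : Subset n} {v} → ∣ q ∣ < ∣ p ∣ → v ∈ q → v ∉ p →
              ∃[ x ] ∃[ y ] y ≢ x × (x ∈ p × x ∉ q) × (y ∈ p × y ∉ q)
two-outside q<p v∈q v∉p with ∣q∣<∣p∣⇒p⊈q q<p
... | x , x∈p , x∉q with ∣q∣<∣p∣⇒p⊈q (≤-<-trans (∣exchange∣≤ v∈q x) q<p)
... | y , y∈p , y∉ with ∉-exchange v∉p y∈p y∉
... | y∉q , y≢x = x , y , y≢x , (x∈p , x∉q) , (y∈p , y∉q)

disjoint-avoid : ∀ {n} {p q r s : Fin n} →
  p ≢ r → p ≢ s → q ≢ r → q ≢ s →
  ∀ t → (p ≢ t × q ≢ t) ⊎ (r ≢ t × s ≢ t)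
disjoint-avoid {p = p} {q} p≢r p≢s q≢r q≢s t with p ≟ t | q ≟ t
... | yes refl | _        = inj₂ (≢-sym p≢r , ≢-sym p≢s)
... | no _     | yes refl = inj₂ (≢-sym q≢r , ≢-sym q≢s)
... | no p≢t   | no q≢t   = inj₁ (p≢t , q≢t)

-- From a degree gap to two private neighbours.

module _ {n} (G : Graph n) where
  open Graph G renaming (sym to ~-sym)

  ∈-neighbours⁺ : ∀ {v u} → v ~ u → u ∈ neighbours v
  ∈-neighbours⁺ {v} {u} v~u =
    lookup⇒[]= u _ (trans (lookup∘tabulate _ u) (dec-true (v ~? u) v~u))

  ∈-neighbours⁻ : ∀ {v u} → u ∈ neighbours v → v ~ u
  ∈-neighbours⁻ {v} {u} u∈ with v ~? u | trans (sym (lookup∘tabulate _ u)) ([]=⇒lookup u∈)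
  ... | yes v~u | _  = v~u
  ... | no  _   | ()

  -- The remaining inequalities follow from the adjacencies; `u ~ w` and `x ~ y` are left
  -- undetermined.
  record PrivatePair (u w x y : Fin n) : Set where
    field
      x≢y : x ≢ y
      x≢w : x ≢ w
      y≢w : y ≢ w
      u~x : u ~ x
      u~y : u ~ y
      x≁w : ¬ x ~ w
      y≁w : ¬ y ~ w

  privatePair : ∀ {u w v} → v ~ w → u ≢ v → ¬ u ~ v → degree w < degree u →
                ∃[ x ] ∃[ y ] PrivatePair u w x y
  privatePair {u} {w} {v} v~w u≢v u≁v w<u = go (u ~? w)
    where
    v∈N[w] : v ∈ neighbours w
    v∈N[w] = ∈-neighbours⁺ (~-sym v~w)

    v∉N[u] : v ∉ neighbours u
    v∉N[u] = u≁v ∘ ∈-neighbours⁻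

    u∉N[u] : u ∉ neighbours u
    u∉N[u] = irrefl refl ∘ ∈-neighbours⁻

    -- Here `q` plays the role of N(w): whatever in N(u) escapes `q` must also escape N(w) and `w`
    -- itself.
    result : ∀ q → ∣ q ∣ < degree u → v ∈ q →
             (∀ {y} → y ∈ neighbours u → y ∉ q → y ∉ neighbours w × y ≢ w) →
             ∃[ x ] ∃[ y ] PrivatePair u w x y
    result q q<p v∈q out with two-outside q<p v∈q v∉N[u]
    ... | x , y , y≢x , (x∈ , x∉) , (y∈ , y∉) = x , y , record
      { x≢y = ≢-sym y≢x
      ; x≢w = proj₂ (out x∈ x∉)
      ; y≢w = proj₂ (out y∈ y∉)
      ; u~x = ∈-neighbours⁻ x∈
      ; u~y = ∈-neighbours⁻ y∈
      ; x≁w = proj₁ (out x∈ x∉) ∘ ∈-neighbours⁺ ∘ ~-sym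
      ; y≁w = proj₁ (out y∈ y∉) ∘ ∈-neighbours⁺ ∘ ~-sym
      }

    -- If u ~ w, then u in N(w) is traded for w, so that w itself is not
    -- counted as one of the two private neighbours of u.
    go : _ → ∃[ x ] ∃[ y ] PrivatePair u w x y
    go (yes u~w) = result (exchange (neighbours w) u w)
      (≤-<-trans (∣exchange∣≤ (∈-neighbours⁺ (~-sym u~w)) w) w<u)
      (∈-exchange w v∈N[w] (≢-sym u≢v))
      (∉-exchange u∉N[u])
    go (no u≁w) = result (neighbours w) w<u v∈N[w]
      λ y∈ y∉ → y∉ , λ { refl → u≁w (∈-neighbours⁻ y∈) }

  -- The common target of the three graph classes. It speaks only of adjacencies and distinctness
  -- among five vertices, so it passes to induced subgraphs without restricting a matroid.
  Unobstructed : Set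
  Unobstructed = ∀ {u w v x y} → v ~ w → u ≢ v → ¬ u ~ v → ¬ PrivatePair u w x y

  module _ {u x v w} (u~x : u ~ x) (v~w : v ~ w) (u≁v : ¬ u ~ v) (x≁w : ¬ x ~ w)
           (u≢v : u ≢ v) (x≢w : x ≢ w) where

    alternating : AlternatingFourCycle u x v w
    alternating = record
      { distinct = ((λ { refl → irrefl refl u~x }) ∷ u≢v ∷ u≢w ∷ [])
                 ∷ ((λ { refl → u≁v u~x }) ∷ x≢w ∷ [])
                 ∷ ((λ { refl → irrefl refl v~w }) ∷ [])
                 ∷ [] ∷ []
      ; ab-edge = u~x
      ; cd-edge = v~w
      ; ac-non  = u≁v
      ; bd-non  = x≁w
      }
      where
      u≢w : u ≢ w
      -- The vertex `x` is adjacent to `u` but not to `w`.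
      u≢w refl = x≁w (~-sym u~x)

  threshold⇒unobstructed : Threshold G → Unobstructed
  threshold⇒unobstructed thr v~w u≢v u≁v P =
    thr (alternating u~x v~w u≁v x≁w u≢v x≢w)
    where open PrivatePair P

  -- Matrogenic graphs: eliminating a vertex.

  data Among (u w x y : Fin n) : Fin n → Set where
    is-u : Among u w x y u
    is-w : Among u w x y w
    is-x : Among u w x y x
    is-y : Among u w x y y

  module _ {u w x y} (P : PrivatePair u w x y) where
    open PrivatePair P

    -- Without `u`, only `w`, `x`, `y` remain, and `w` is adjacent to neither of the others.
    edge-avoiding-u : ∀ {p q} → Among u w x y p → Among u w x y q →
                      p ~ q → p ≢ u × q ≢ u → x ~ y
    edge-avoiding-u is-u _    _   (p≢ , _) = contradiction refl p≢
    edge-avoiding-u _    is-u _   (_ , q≢) = contradiction refl q≢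
    edge-avoiding-u is-w is-w p~q _ = contradiction p~q (irrefl refl)
    edge-avoiding-u is-w is-x p~q _ = contradiction (~-sym p~q) x≁w
    edge-avoiding-u is-w is-y p~q _ = contradiction (~-sym p~q) y≁w
    edge-avoiding-u is-x is-w p~q _ = contradiction p~q x≁w
    edge-avoiding-u is-x is-x p~q _ = contradiction p~q (irrefl refl)
    edge-avoiding-u is-x is-y p~q _ = p~q
    edge-avoiding-u is-y is-w p~q _ = contradiction p~q y≁w
    edge-avoiding-u is-y is-x p~q _ = ~-sym p~q
    edge-avoiding-u is-y is-y p~q _ = contradiction p~q (irrefl refl)

    -- Dually, without `w` only `u`, `x`, `y` remain, and `u` is adjacent to both others. Here
    -- `p ≢ q` rules out the trivial non-edges from a vertex to itself.
    non-edge-avoiding-w : ∀ {p q} → Among u w x y p → Among u w x y q →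
                          p ≢ q → ¬ p ~ q → p ≢ w × q ≢ w → ¬ x ~ y
    non-edge-avoiding-w is-w _    _   _   (p≢ , _) = contradiction refl p≢
    non-edge-avoiding-w _    is-w _   _   (_ , q≢) = contradiction refl q≢
    non-edge-avoiding-w is-u is-u p≢q _   _ = contradiction refl p≢q
    non-edge-avoiding-w is-u is-x _   p≁q _ = contradiction u~x p≁q
    non-edge-avoiding-w is-u is-y _   p≁q _ = contradiction u~y p≁q
    non-edge-avoiding-w is-x is-u _   p≁q _ = contradiction (~-sym u~x) p≁q
    non-edge-avoiding-w is-x is-x p≢q _   _ = contradiction refl p≢q
    non-edge-avoiding-w is-x is-y _   p≁q _ = p≁q
    non-edge-avoiding-w is-y is-u _   p≁q _ = contradiction (~-sym u~y) p≁q
    non-edge-avoiding-w is-y is-x _   p≁q _ = p≁q ∘ ~-sym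
    non-edge-avoiding-w is-y is-y p≢q _   _ = contradiction refl p≢q

    -- One of the two disjoint edges avoids u, hence is xy; one of the two
    -- disjoint non-edges avoids w, hence is xy as well.
    ¬alternating-among : ∀ {a b c d} → AlternatingFourCycle a b c d →
      Among u w x y a → Among u w x y b → Among u w x y c → Among u w x y d → ⊥
    ¬alternating-among
      record { distinct = (a≢b ∷ a≢c ∷ a≢d ∷ []) ∷ (b≢c ∷ b≢d ∷ []) ∷ (c≢d ∷ []) ∷ _
             ; ab-edge = a~b ; cd-edge = c~d ; ac-non = a≁c ; bd-non = b≁d }
      a∈ b∈ c∈ d∈ = x≁y x~y
      where
      x~y : x ~ y
      x~y with disjoint-avoid a≢c a≢d b≢c b≢d u
      ... | inj₁ ab≢u = edge-avoiding-u a∈ b∈ a~b ab≢u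
      ... | inj₂ cd≢u = edge-avoiding-u c∈ d∈ c~d cd≢u

      x≁y : ¬ x ~ y
      x≁y with disjoint-avoid a≢b a≢d (≢-sym b≢c) c≢d w
      ... | inj₁ ac≢w = non-edge-avoiding-w a∈ c∈ a≢c a≁c ac≢w
      ... | inj₂ bd≢w = non-edge-avoiding-w b∈ d∈ b≢d b≁d bd≢w

  matrogenic⇒unobstructed : Matrogenic G → Unobstructed
  matrogenic⇒unobstructed (M , iff) {u} {w} {v} {x} {y} v~w u≢v u≁v P = absurd
    where
    open PrivatePair P
    open Pred using (｛_｝) renaming (_∪_ to _∪ₚ_)

    S T : Pred.Pred (Fin n) _
    S = ｛ u ｝ ∪ₚ ｛ x ｝ ∪ₚ ｛ v ｝ ∪ₚ ｛ w ｝
    T = ｛ u ｝ ∪ₚ ｛ y ｝ ∪ₚ ｛ v ｝ ∪ₚ ｛ w ｝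

    circuit-S : Matroid.Circuit M S
    circuit-S = Equivalence.to (iff S)
      (u , x , v , w , alternating u~x v~w u≁v x≁w u≢v x≢w , (λ z → z) , (λ z → z))

    circuit-T : Matroid.Circuit M T
    circuit-T = Equivalence.to (iff T)
      (u , y , v , w , alternating u~y v~w u≁v y≁w u≢v y≢w , (λ z → z) , (λ z → z))

    -- Elimination needs distinct circuits; `x` tells `S` from `T`.
    x∉T : ¬ T x
    x∉T (inj₁ refl)                 = irrefl refl u~x
    x∉T (inj₂ (inj₁ refl))          = x≢y refl
    x∉T (inj₂ (inj₂ (inj₁ refl)))   = u≁v u~x
    x∉T (inj₂ (inj₂ (inj₂ refl)))   = x≢w refl

    among : ∀ {z} → (S ∪ₚ T) z → v ≢ z → Among u w x y z
    among (inj₁ (inj₁ refl))               _   = is-u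
    among (inj₁ (inj₂ (inj₁ refl)))        _   = is-x
    among (inj₁ (inj₂ (inj₂ (inj₁ refl)))) v≢z = contradiction refl v≢z
    among (inj₁ (inj₂ (inj₂ (inj₂ refl)))) _   = is-w
    among (inj₂ (inj₁ refl))               _   = is-u
    among (inj₂ (inj₂ (inj₁ refl)))        _   = is-y
    among (inj₂ (inj₂ (inj₂ (inj₁ refl)))) v≢z = contradiction refl v≢z
    among (inj₂ (inj₂ (inj₂ (inj₂ refl)))) _   = is-w

    absurd : ⊥
    -- The two membership proofs pick out `v`, the third vertex of both cycles, as the element to
    -- eliminate.
    absurd with Matroid.elimination M circuit-S circuit-T
                  (λ S≐T → x∉T (proj₁ S≐T (inj₂ (inj₁ refl))))
                  (inj₂ (inj₂ (inj₁ refl))) (inj₂ (inj₂ (inj₁ refl)))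
    ... | U , circuit-U , U⊆ with Equivalence.from (iff U) circuit-U
    ... | a , b , c , d , cycle , _ , ⊆U =
      ¬alternating-among P cycle
        (member (inj₁ refl)) (member (inj₂ (inj₁ refl)))
        (member (inj₂ (inj₂ (inj₁ refl)))) (member (inj₂ (inj₂ (inj₂ refl))))
      where
      member : ∀ {z} → (｛ a ｝ ∪ₚ ｛ b ｝ ∪ₚ ｛ c ｝ ∪ₚ ｛ d ｝) z → Among u w x y z
      member z∈ = among (proj₁ (U⊆ (⊆U z∈))) (proj₂ (U⊆ (⊆U z∈)))

  -- Matroidal graphs: eliminating an edge.

  edge : ∀ {a b} → a ~ b → ∃[ e ] Joins e a b
  edge {a} {b} a~b with Fin.<-cmp a b
  ... | tri< a<b _ _    = record { lo<hi = a<b ; adj = a~b } , inj₁ (refl , refl)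
  ... | tri≈ _ a≡b _    = contradiction a~b (irrefl a≡b)
  ... | tri> _ _ b<a    = record { lo<hi = b<a ; adj = ~-sym a~b } , inj₂ (refl , refl)

  -- Equal orientations give equal edges by proof irrelevance; opposite ones would require both `a`
  -- < `b` and `b` < `a`.
  Joins-unique : ∀ e f {a b} → Joins e a b → Joins f a b → e ≡ f
  Joins-unique _ _ (inj₁ (refl , refl)) (inj₁ (refl , refl)) = refl
  Joins-unique _ _ (inj₂ (refl , refl)) (inj₂ (refl , refl)) = refl
  Joins-unique record { lo<hi = p } record { lo<hi = q }
    (inj₁ (refl , refl)) (inj₂ (refl , refl)) = ⊥-elim-irr (Fin.<-asym p q)
  Joins-unique record { lo<hi = p } record { lo<hi = q }
    (inj₂ (refl , refl)) (inj₁ (refl , refl)) = ⊥-elim-irr (Fin.<-asym p q)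

  Joins-ends : ∀ e {a b c d} → Joins e a b → Joins e c d →
               (a ≡ c × b ≡ d) ⊎ (b ≡ c × a ≡ d)
  Joins-ends _ (inj₁ (refl , refl)) (inj₁ (refl , refl)) = inj₁ (refl , refl)
  Joins-ends _ (inj₁ (refl , refl)) (inj₂ (refl , refl)) = inj₂ (refl , refl)
  Joins-ends _ (inj₂ (refl , refl)) (inj₁ (refl , refl)) = inj₂ (refl , refl)
  Joins-ends _ (inj₂ (refl , refl)) (inj₂ (refl , refl)) = inj₁ (refl , refl)

  matroidal⇒unobstructed : Matroidal G → Unobstructed
  matroidal⇒unobstructed (M , iff) {u} {w} {v} {x} {y} v~w u≢v u≁v P = absurd
    where
    open PrivatePair P

    S T : Pred.Pred Edge _
    S e = Joins e u x ⊎ Joins e v w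
    T e = Joins e u y ⊎ Joins e v w

    circuit-S : Matroid.Circuit M S
    circuit-S = Equivalence.to (iff S)
      (u , x , v , w , alternating u~x v~w u≁v x≁w u≢v x≢w , (λ z → z) , (λ z → z))

    circuit-T : Matroid.Circuit M T
    circuit-T = Equivalence.to (iff T)
      (u , y , v , w , alternating u~y v~w u≁v y≁w u≢v y≢w , (λ z → z) , (λ z → z))

    -- The edge joining `u` and `x` shows that the two circuits differ.
    ux∉T : ∀ e → Joins e u x → ¬ T e
    ux∉T e ux (inj₁ uy) with Joins-ends e ux uy
    ... | inj₁ (_ , x≡y) = x≢y x≡y
    ... | inj₂ (_ , u≡y) = irrefl u≡y u~y
    ux∉T e ux (inj₂ vw) with Joins-ends e ux vw
    ... | inj₁ (u≡v , _)    = u≢v u≡v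
    ... | inj₂ (_ , refl)   = x≁w (~-sym u~x)

    ux : ∃[ e ] Joins e u x
    ux = edge u~x

    vw : ∃[ e ] Joins e v w
    vw = edge v~w

    -- Once the edge joining `v` and `w` is removed, only the edges from `u` to `x` and `y` are
    -- left.
    meets-u : ∀ e {p q} → Joins e p q → (S e ⊎ T e) → proj₁ vw ≢ e → p ≡ u ⊎ q ≡ u
    meets-u e pq (inj₁ (inj₁ ux)) _ with Joins-ends e pq ux
    ... | inj₁ (p≡u , _) = inj₁ p≡u
    ... | inj₂ (q≡u , _) = inj₂ q≡u
    meets-u e pq (inj₂ (inj₁ uy)) _ with Joins-ends e pq uy
    ... | inj₁ (p≡u , _) = inj₁ p≡u
    ... | inj₂ (q≡u , _) = inj₂ q≡u
    meets-u e _ (inj₁ (inj₂ vw′)) ≢e = contradiction (Joins-unique _ e (proj₂ vw) vw′) ≢e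
    meets-u e _ (inj₂ (inj₂ vw′)) ≢e = contradiction (Joins-unique _ e (proj₂ vw) vw′) ≢e

    absurd : ⊥
    absurd with Matroid.elimination M {e = proj₁ vw} circuit-S circuit-T
                  (λ S≐T → ux∉T (proj₁ ux) (proj₂ ux) (proj₁ S≐T {proj₁ ux} (inj₁ (proj₂ ux))))
                  (inj₂ (proj₂ vw)) (inj₂ (proj₂ vw))
    ... | U , circuit-U , U⊆ with Equivalence.from (iff U) circuit-U
    ... | a , b , c , d
        , record { distinct = (_ ∷ a≢c ∷ a≢d ∷ []) ∷ (b≢c ∷ b≢d ∷ []) ∷ _
                 ; ab-edge = a~b ; cd-edge = c~d }
        , _ , ⊆U with edge a~b | edge c~d
    ... | e , ab | f , cd
      with meets-u e ab (proj₁ (U⊆ {e} (⊆U (inj₁ ab)))) (proj₂ (U⊆ {e} (⊆U (inj₁ ab))))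
         | meets-u f cd (proj₁ (U⊆ {f} (⊆U (inj₂ cd)))) (proj₂ (U⊆ {f} (⊆U (inj₂ cd))))
    -- Both edges of the cycle obtained from `U` contain `u`, yet they share no vertex.
    ... | inj₁ refl | inj₁ refl = a≢c refl
    ... | inj₁ refl | inj₂ refl = a≢d refl
    ... | inj₂ refl | inj₁ refl = b≢c refl
    ... | inj₂ refl | inj₂ refl = b≢d refl

-- Induced subgraphs and the conclusion.

unobstructed-induced : ∀ {m n} (G : Graph n) (f : Fin m ↣ Fin n) →
                       Unobstructed G → Unobstructed (induced G f)
unobstructed-induced G f unobstructed v~w u≢v u≁v P =
  -- Adjacency in `induced G f` is by definition adjacency of images; only distinctness calls on
  -- injectivity.
  unobstructed v~w (u≢v ∘ injective) u≁v record
    { x≢y = x≢y ∘ injective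
    ; x≢w = x≢w ∘ injective
    ; y≢w = y≢w ∘ injective
    ; u~x = u~x
    ; u~y = u~y
    ; x≁w = x≁w
    ; y≁w = y≁w
    }
  where
  open Injection f using (injective)
  open PrivatePair P

unobstructed⇒strongHavelHakimi : ∀ {n} (G : Graph n) → Unobstructed G → StrongHavelHakimi G
unobstructed⇒strongHavelHakimi G unobstructed f v max =
  -- The degrees are those of the induced subgraph, so the counting is done there; only the
  -- resulting five-vertex pattern is carried over to `G`.
  max , λ w u v~w u≢v v≁u → ≮⇒≥ λ w<u →
    let u≁v          = v≁u ∘ Graph.sym G
        _ , _ , pair = privatePair (induced G f) v~w u≢v u≁v w<u
    in unobstructed-induced G f unobstructed v~w u≢v u≁v pair

corollary2 : ∀ {n} (G : Graph n) →
    (Matrogenic G → StrongHavelHakimi G) ×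
    (Matroidal G → StrongHavelHakimi G) ×
    (Threshold G → StrongHavelHakimi G)
corollary2 G =
  unobstructed⇒strongHavelHakimi G ∘ matrogenic⇒unobstructed G ,
  unobstructed⇒strongHavelHakimi G ∘ matroidal⇒unobstructed G ,
  unobstructed⇒strongHavelHakimi G ∘ threshold⇒unobstructed G
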